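{- Let $\lambda$ be a partition and let $\Lambda,\Lambda'\in\mathrm{RPP}(\lambda)$ satisfy $g(\Lambda,\Lambda')=0$ ($\Lambda$ is called blue, $\Lambda'$ red). For each $i$, shift the $i$-th blue border strip (with its entries) and the $(i+1)$-th red border strip (with its entries) diagonally by $i$ steps, each step decreasing both the row and the column index by one, and discard the cells that leave the Young diagram; the first red border strip is not moved. Explicitly, define a filling $\Lambda''$ of the cells of $\lambda$ by $$\Lambda''(a,b)=\begin{cases}\Lambda'(a+r-1,\,b+r-1) & \text{if } (a,b) \text{ lies in the } (2r-1)\text{ -th border strip of }\lambda,\\ \Lambda(a+r,\,b+r) & \text{if } (a,b)\text{ lies in the } 2r\text{ -th border strip of }\lambda,\end{cases}\qquad r\ge1.$$ Then $\Lambda''$ is a valid reverse plane partition of shape $\lambda$.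
   Context: Partitions and RPPs. $\lambda=(\lambda_1\ge\dots\ge\lambda_\ell>0)$ is an integer partition, $\ell=\ell(\lambda)$, $\lambda'$ is the conjugate partition. The cells of $\lambda$ are the pairs $(i,j)$ with $1\le i\le \ell$, $1\le j\le\lambda_i$ ($i$ is the row, numbered from the bottom, $j$ the column). A reverse plane partition (RPP) of shape $\lambda$ is a map $\Lambda$ from the cells of $\lambda$ to the non-negative integers that is weakly increasing in $i$ and weakly increasing in $j$; $\mathrm{RPP}(\lambda)$ is the set of these. Conventions: $\Lambda(i,0)=\Lambda(0,j)=0$. Border strips. The border strips of $\lambda$ are obtained by removing the largest border strip (the whole outer rim) of $\lambda$, then the largest border strip of what remains, and so on; they are ordered from outermost to innermost. Equivalently, the cell $(a,b)$ lies in the $s$-th border strip, where $s=\max\{r\ge1:(a+r-1,b+r-1)\in\lambda\}$. The $s$-th blue (resp. red) border strip is the $s$-th border strip filled with the entries of $\Lambda$ (resp. $\Lambda'$). Shifting the path drawn on the lozenge tiling along a border strip vertically down by one step corresponds to shifting the filled border strip diagonally by one step. Coupled pairs. View an RPP as a stack of $\Lambda(i,j)$ unit cubes over each cell $(i,j)$, in an infinitely tall room whose back wall follows the boundary of $\lambda$, seen from the corner of small $i,j$; this gives a lozenge tiling. A point $(u,v,h)$ ($u$ in the row direction index $i$, $v$ in the column direction index $j$, $h$ height) is projected to horizontal coordinate $v-u$ and vertical coordinate $h+(u+v)/2$. The picture is cut into vertical slices $[d,d+1]$, $d=-\ell,\dots,\lambda_1-1$. A slice $d$ is a hole slice if $d\in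 H=\{j-1-\lambda'_j:1\le j\le\lambda_1\}$ and a particle slice if $d\in D=\{\lambda_i-i:1\le i\le \ell\}$ ($H$ and $D$ partition $\{ -\ell,\dots,\lambda_1-1\}$). There are three lozenge types: top faces of stacks; "left" faces, separating $(i,j-1)$ from $(i,j)$; "right" faces, separating $(i-1,j)$ from $(i,j)$. Recording each lozenge, up to a shift depending only on $d$, by the vertical position of the unit vertical segment at horizontal coordinate $d+1$ (the right edge of a left or right face in slice $d$, or the short diagonal of a top face centred at $d+1$), set - for $d\in H$: $O_d(\Lambda)=\{h+i : (i,j)\in\lambda,\ j-i=d+1,\ h\in\mathbb Z,\ \Lambda(i,j-1)<h\le\Lambda(i,j)\}$ (left faces in slice $d$); - for $d\in D$: $B_d(\Lambda)=\{h+i : (i,j)\in\lambda,\ j-i=d,\ h\in\mathbb Z,\ \Lambda(i-1,j)<h\le\Lambda(i,j)\}$ (right faces in slice $d$); - for all $d$: $T_d(\Lambda)=\{\Lambda(i,j)+i+1 : (i,j)\in\lambda,\ j-i=d+1\}$ (top faces). When the tilings of $\Lambda$ ("blue") and $\Lambda'$ ("red") are superimposed, a coupled pair is one of: (type 1) in a hole slice, a blue left face whose right edge is the short diagonal of a red top face; (type 2) in a hole slice, a blue and a red left face in the same position; (type 3) in a particle slice, a blue and a red right face in the same position; (type 4) in a particle slice, a red right face whose right edge is the short diagonal of a blue top face. Then $g(\Lambda,\Lambda')$ is the number of coupled pairs, i.e. $$g(\Lambda,\Lambda')=\sum_{d\in H}\big(|O_d(\Lambda)\cap T_d(\Lambda')|+|O_d(\Lambda)\cap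 O_d(\Lambda')|\big)+\sum_{d\in D}\big(|B_d(\Lambda)\cap B_d(\Lambda')|+|T_d(\Lambda)\cap B_d(\Lambda')|\big).$$ -}

module Defs where

open import Data.Integer as ℤ using (ℤ; +_)
import Data.Integer.Properties as ℤ
open import Data.List using (List; []; _∷_; length; map; filter; concatMap; applyUpTo; deduplicate)
import Data.List.Extrema.Nat as Extrema
import Data.List.Membership.DecPropositional as DecMembership
open import Data.List.Relation.Unary.All using (All)
open import Data.List.Relation.Unary.Linked using (Linked)
open import Data.Nat using (ℕ; zero; suc; parity; _+_; _∸_; _≤_; _≥_; _>_; _≤?_; _<?_; _≟_; ⌈_/2⌉)
open import Data.Nat.ListAction using (sum)
open import Data.Parity.Base using (Parity; 0ℙ; 1ℙ)
open import Data.Product using (_×_; _,_)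
open import Relation.Binary.PropositionalEquality using (_≡_)
open import Relation.Nullary using (Dec; yes; no)
open import Relation.Nullary.Decidable using (_×-dec_)

-- Finite sets are represented by lists; repetitions are discarded whenever a
-- cardinality or a sum over the set is taken.

∣_∩_∣ : List ℕ → List ℕ → ℕ
∣ X ∩ Y ∣ = length (deduplicate _≟_ (filter (_∈? Y) X))
  where open DecMembership _≟_ using (_∈?_)

∑[_] : List ℤ → (ℤ → ℕ) → ℕ
∑[ S ] f = sum (map f (deduplicate ℤ._≟_ S))

[1⋯_] : ℕ → List ℕ
[1⋯ n ] = applyUpTo suc n

-- { h : m < h ≤ n }
⟨_,_] : ℕ → ℕ → List ℕ
⟨ m , n ] = filter (m <?_) [1⋯ n ]

record Partition : Set where
  field
    parts      : List ℕ
    decreasing : Linked _≥_ parts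
    positive   : All (_> 0) parts

open Partition public

ℓ : Partition → ℕ
ℓ μ = length (parts μ)

-- 1-based, 0 when out of range
nth : List ℕ → ℕ → ℕ
nth []       _             = 0
nth (x ∷ xs) zero          = 0
nth (x ∷ xs) (suc zero)    = x
nth (x ∷ xs) (suc (suc i)) = nth xs (suc i)

part : Partition → ℕ → ℕ
part μ i = nth (parts μ) i

conjugatePart : Partition → ℕ → ℕ
conjugatePart μ j = length (filter (j ≤?_) (parts μ))

infix 4 _∈ᵈ_ _∈ᵈ?_

_∈ᵈ_ : ℕ × ℕ → Partition → Set
(i , j) ∈ᵈ μ = (1 ≤ i × i ≤ ℓ μ) × (1 ≤ j × j ≤ part μ i)

_∈ᵈ?_ : ∀ c μ → Dec (c ∈ᵈ μ)
(i , j) ∈ᵈ? μ = (1 ≤? i ×-dec i ≤? ℓ μ) ×-dec (1 ≤? j ×-dec j ≤? part μ i)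

record Cell (μ : Partition) : Set where
  constructor cell
  field
    row     : ℕ
    col     : ℕ
    .inside : (row , col) ∈ᵈ μ

open Cell public using (row; col)

Filling : Partition → Set
Filling μ = Cell μ → ℕ

record IsRPP {μ : Partition} (Λ : Filling μ) : Set where
  field
    increasing-in-row-index : ∀ c c′ → col c ≡ col c′ → row c ≤ row c′ → Λ c ≤ Λ c′
    increasing-in-col-index : ∀ c c′ → row c ≡ row c′ → col c ≤ col c′ → Λ c ≤ Λ c′

-- Extension by 0 outside the diagram, which gives Λ(i,0) = Λ(0,j) = 0.
-- Apart from row 0 and column 0, it is only ever evaluated inside the diagram.
_at_ : ∀ {μ} → Filling μ → ℕ × ℕ → ℕ
_at_ {μ} Λ (i , j) with (i , j) ∈ᵈ? μ
... | yes p = Λ (cell i j p)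
... | no  _ = 0

holes : Partition → List ℤ
holes μ = map (λ j → + j ℤ.- + 1 ℤ.- + conjugatePart μ j) [1⋯ part μ 1 ]

particles : Partition → List ℤ
particles μ = map (λ i → + part μ i ℤ.- + i) [1⋯ ℓ μ ]

cells : Partition → List (ℕ × ℕ)
cells μ = concatMap (λ i → map (i ,_) [1⋯ part μ i ]) [1⋯ ℓ μ ]

diagonal : Partition → ℤ → List (ℕ × ℕ)
diagonal μ e = filter (λ (i , j) → + j ℤ.- + i ℤ.≟ e) (cells μ)

module _ {μ : Partition} (Λ : Filling μ) where

  -- In leftFaces and rightFaces the height h exceeds an entry of Λ, hence it
  -- ranges over ℕ without loss.
  leftFaces : ℤ → List ℕ
  leftFaces d =
    concatMap (λ (i , j) → map (_+ i) ⟨ Λ at (i , j ∸ 1) , Λ at (i , j) ])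
              (diagonal μ (d ℤ.+ + 1))

  rightFaces : ℤ → List ℕ
  rightFaces d =
    concatMap (λ (i , j) → map (_+ i) ⟨ Λ at (i ∸ 1 , j) , Λ at (i , j) ])
              (diagonal μ d)

  topFaces : ℤ → List ℕ
  topFaces d = map (λ (i , j) → Λ at (i , j) + i + 1) (diagonal μ (d ℤ.+ + 1))

g : ∀ {μ} → Filling μ → Filling μ → ℕ
g {μ} Λ Λ′ =
    ∑[ holes μ ] (λ d → ∣ leftFaces Λ d ∩ topFaces Λ′ d ∣
                      + ∣ leftFaces Λ d ∩ leftFaces Λ′ d ∣)
  + ∑[ particles μ ] (λ d → ∣ rightFaces Λ d ∩ rightFaces Λ′ d ∣
                          + ∣ topFaces Λ d ∩ rightFaces Λ′ d ∣)

-- max { r ≥ 1 : (a + r - 1 , b + r - 1) ∈ μ }; the search range suffices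
-- because a + r - 1 ≤ ℓ μ and a ≥ 1 force r ≤ ℓ μ.
stripIndex : (μ : Partition) → Cell μ → ℕ
stripIndex μ (cell a b _) =
  Extrema.max 0 (filter (λ r → (a + r ∸ 1 , b + r ∸ 1) ∈ᵈ? μ) [1⋯ ℓ μ ])

-- The filling Λ″ obtained from Λ (blue) and Λ′ (red).  A strip index s is
-- 2r - 1 or 2r for the same r = ⌈ s /2⌉, according to its parity.
shiftStrips : ∀ {μ} → Filling μ → Filling μ → Filling μ
shiftStrips {μ} Λ Λ′ c@(cell a b _) = entry (parity s)
  where
  s r : ℕ
  s = stripIndex μ c
  r = ⌈ s /2⌉

  entry : Parity → ℕ
  entry 1ℙ = Λ′ at (a + r ∸ 1 , b + r ∸ 1)
  entry 0ℙ = Λ at (a + r , b + r)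

{-# OPTIONS --safe #-}
-- Read diagonal by diagonal, the entries of an RPP form non-crossing paths:
-- passing from diagonal d to d + 1 they go weakly up in a hole slice and weakly
-- down in a particle slice, and the faces of the slice are the heights crossed.
-- Absence of coupled pairs lets two inequalities spread over all diagonals.
-- From left to right, Λ(i,j) ≤ Λ′(i,j); the slice even gives
-- Λ(i,j) ≤ Λ′(i,j-1) (hole) or Λ(i,j) ≤ Λ′(i-1,j) (particle).
-- From right to left, Λ′(i,j) ≤ Λ(i+1,j+1); the slice even gives
-- Λ′(i,j) ≤ Λ(i+1,j) (hole) or Λ′(i,j) ≤ Λ(i,j+1) (particle).
-- Neighbouring cells of Λ″ lie in the same strip or in consecutive ones, and in
-- the latter case the comparison between them is one of the four slice inequalities.
module Submission where

open import Defs
open import Relation.Binary.PropositionalEquality using (_≡_; refl; sym; trans; cong; cong₂; subst; subst₂)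
open import Data.Nat using (ℕ; zero; suc; parity; _+_; _∸_; _≤_; _<_; _≥_; _≤′_; ≤′-refl; ≤′-step; z≤n; s≤s; s≤s⁻¹; _≤?_; _<?_; _≟_; ⌈_/2⌉)
open import Data.Nat.Properties
open import Data.Nat.ListAction using (sum)
open import Data.Integer as ℤ using (ℤ; +_; -[1+_])
import Data.Integer.Properties as ℤ
import Data.List.Extrema.Nat as Extrema
open import Data.List using (List; []; _∷_; length; map; filter)
open import Data.List.Properties using (filter-accept; filter-reject)
import Data.List.Membership.DecPropositional as DecMembership
open import Data.List.Membership.Propositional using (_∈_; lose)
open import Data.List.Membership.Propositional.Properties
open import Data.List.Relation.Unary.All as All using ()
open import Data.List.Relation.Unary.Any using (here; there)
open import Data.List.Relation.Unary.Linked as Linked using (Linked; [-]; _∷_)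
open import Data.Parity.Base using (Parity; 0ℙ; 1ℙ)
open import Data.Product using (_×_; _,_; proj₁; proj₂; ∃-syntax)
open import Data.Sum using (_⊎_; inj₁; inj₂)
open import Data.Empty using (⊥)
open import Relation.Nullary using (¬_; Dec; yes; no; contradiction)
open import Relation.Nullary.Decidable using (recompute)

-- Vanishing sums and disjoint lists.

∈⇒≤sum : ∀ {x xs} → x ∈ xs → x ≤ sum xs
∈⇒≤sum {xs = y ∷ xs} (here refl) = m≤m+n y (sum xs)
∈⇒≤sum {xs = y ∷ xs} (there x∈xs) = ≤-trans (∈⇒≤sum x∈xs) (m≤n+m (sum xs) y)

∑≡0⇒≡0 : ∀ {S f d} → ∑[ S ] f ≡ 0 → d ∈ S → f d ≡ 0
∑≡0⇒≡0 {f = f} ∑≡0 d∈S =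
  n≤0⇒n≡0 (subst (_ ≤_) ∑≡0 (∈⇒≤sum (∈-map⁺ f (∈-deduplicate⁺ ℤ._≟_ d∈S))))

∣∩∣≡0⇒disjoint : ∀ {X Y} → ∣ X ∩ Y ∣ ≡ 0 → ∀ {v} → v ∈ X → v ∈ Y → ⊥
∣∩∣≡0⇒disjoint {Y = Y} ∣X∩Y∣≡0 v∈X v∈Y =
  <⇒≢ (∈-length (∈-deduplicate⁺ _≟_ (∈-filter⁺ (_∈? Y) v∈X v∈Y))) (sym ∣X∩Y∣≡0)
  where open DecMembership _≟_ using (_∈?_)

∈-[1⋯] : ∀ {i n} → 1 ≤ i → i ≤ n → i ∈ [1⋯ n ]
∈-[1⋯] {suc i} _ i<n = ∈-applyUpTo⁺ suc i<n

∈-⟨] : ∀ {m n h} → m < h → h ≤ n → h ∈ ⟨ m , n ]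
∈-⟨] {m} m<h h≤n = ∈-filter⁺ (m <?_) (∈-[1⋯] (≤-trans (s≤s z≤n) m<h) h≤n) m<h

-- Contents of cells.

δ : ℕ → ℕ → ℤ
δ i j = + j ℤ.- + i

δ-suc : ∀ i j → δ (suc i) (suc j) ≡ δ i j
δ-suc i j = trans (ℤ.[1+m]⊖[1+n]≡m⊖n j i) (sym (ℤ.m-n≡m⊖n j i))

δ-+ : ∀ k i j → δ (k + i) (k + j) ≡ δ i j
δ-+ zero i j = refl
δ-+ (suc k) i j = trans (δ-suc (k + i) (k + j)) (δ-+ k i j)

δ-next : ∀ i j → δ i j ≡ δ (suc i) j ℤ.+ + 1
δ-next i j = trans (sym (δ-suc i j))
  (trans (cong (λ n → + n ℤ.- + suc i) (sym (+-comm j 1)))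
    (trans (ℤ.+-assoc (+ j) (+ 1) -[1+ i ])
      (trans (cong (ℤ._+_ (+ j)) (ℤ.+-comm (+ 1) -[1+ i ]))
        (sym (ℤ.+-assoc (+ j) -[1+ i ] (+ 1))))))

-- Parts and column lengths.

nth-tail≤head : ∀ {x xs} → Linked _≥_ (x ∷ xs) → ∀ i → nth xs i ≤ x
nth-tail≤head [-] i = z≤n
nth-tail≤head (x≥y ∷ ys) zero = z≤n
nth-tail≤head (x≥y ∷ ys) (suc zero) = x≥y
nth-tail≤head (x≥y ∷ ys) (suc (suc i)) = ≤-trans (nth-tail≤head ys (suc i)) x≥y

nth-antitone : ∀ {xs} → Linked _≥_ xs → ∀ {i i′} → 1 ≤ i → i ≤ i′ → nth xs i′ ≤ nth xs i
nth-antitone {[]} _ _ _ = z≤n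
nth-antitone {x ∷ xs} xs↘ {suc zero} {suc zero} _ _ = ≤-refl
nth-antitone {x ∷ xs} xs↘ {suc zero} {suc (suc i′)} _ _ = nth-tail≤head xs↘ (suc i′)
nth-antitone {x ∷ xs} xs↘ {suc (suc i)} {suc (suc i′)} _ (s≤s i≤i′) =
  nth-antitone (Linked.tail xs↘) (s≤s z≤n) i≤i′

nth>0⇒≤length : ∀ xs {i} → 1 ≤ nth xs i → i ≤ length xs
nth>0⇒≤length (x ∷ xs) {suc zero} _ = s≤s z≤n
nth>0⇒≤length (x ∷ xs) {suc (suc i)} p = s≤s (nth>0⇒≤length xs p)

-- The filter keeps exactly the first `I` entries. Since `nth` is 0 past the end, `1 ≤ J` makes the
-- first bound force at least `I` entries.
count-≥ : ∀ J → 1 ≤ J → ∀ xs I → (∀ i → i < I → J ≤ nth xs (suc i)) →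
          (∀ i → I ≤ i → nth xs (suc i) < J) → length (filter (J ≤?_) xs) ≡ I
count-≥ J 1≤J [] zero ge lt = refl
count-≥ J 1≤J [] (suc I) ge lt = contradiction (≤-trans 1≤J (ge 0 (s≤s z≤n))) λ ()
count-≥ J 1≤J (x ∷ xs) zero ge lt =
  trans (cong length (filter-reject (J ≤?_) (<⇒≱ (lt 0 z≤n))))
        (count-≥ J 1≤J xs 0 (λ _ ()) (λ i _ → lt (suc i) z≤n))
count-≥ J 1≤J (x ∷ xs) (suc I) ge lt =
  trans (cong length (filter-accept (J ≤?_) (ge 0 (s≤s z≤n))))
        (cong suc (count-≥ J 1≤J xs I (λ i i<I → ge (suc i) (s≤s i<I))
                                      (λ i I≤i → lt (suc i) (s≤s I≤i))))

-- The Young diagram and its slices.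

module Diagram (μ : Partition) where

  infix 4 _∈λ _∉λ

  _∈λ _∉λ : ℕ × ℕ → Set
  c ∈λ = c ∈ᵈ μ
  c ∉λ = ¬ (c ∈ᵈ μ)

  part-antitone : ∀ {i i′} → 1 ≤ i → i ≤ i′ → part μ i′ ≤ part μ i
  part-antitone = nth-antitone (decreasing μ)

  ∈λ-intro : ∀ {i j} → 1 ≤ i → 1 ≤ j → j ≤ part μ i → (i , j) ∈λ
  ∈λ-intro 1≤i 1≤j j≤ = (1≤i , nth>0⇒≤length (parts μ) (≤-trans 1≤j j≤)) , (1≤j , j≤)

  down : ∀ {i j i′ j′} → (i′ , j′) ∈λ → 1 ≤ i → 1 ≤ j → i ≤ i′ → j ≤ j′ → (i , j) ∈λ
  down (_ , (_ , j′≤)) 1≤i 1≤j i≤i′ j≤j′ =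
    ∈λ-intro 1≤i 1≤j (≤-trans j≤j′ (≤-trans j′≤ (part-antitone 1≤i i≤i′)))

  down-suc : ∀ {i j} → (suc i , suc j) ∈λ → 1 ≤ i → 1 ≤ j → (i , j) ∈λ
  down-suc p 1≤i 1≤j = down p 1≤i 1≤j (n≤1+n _) (n≤1+n _)

  ∈-cells : ∀ {i j} → (i , j) ∈λ → (i , j) ∈ cells μ
  ∈-cells {i} ((1≤i , i≤ℓ) , (1≤j , j≤)) =
    ∈-concatMap⁺ (λ i → map (i ,_) [1⋯ part μ i ])
      (lose (∈-[1⋯] 1≤i i≤ℓ) (∈-map⁺ (i ,_) (∈-[1⋯] 1≤j j≤)))

  ∈-diagonal : ∀ {i j e} → (i , j) ∈λ → δ i j ≡ e → (i , j) ∈ diagonal μ e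
  ∈-diagonal {e = e} p eq = ∈-filter⁺ (λ (i , j) → δ i j ℤ.≟ e) (∈-cells p) eq

  -- Slice d lies between diagonals d and d + 1; a hole slice is named by its right
  -- diagonal and a particle slice by its left one, which carry the faces of the slice.
  HoleDiagonal ParticleDiagonal : ℤ → Set
  HoleDiagonal e = ∃[ d ] d ∈ holes μ × e ≡ d ℤ.+ + 1
  ParticleDiagonal e = e ∈ particles μ

  rowEnd⇒particle : ∀ {i j} → (i , j) ∈λ → (i , suc j) ∉λ → ParticleDiagonal (δ i j)
  rowEnd⇒particle {i} {j} ((1≤i , i≤ℓ) , (1≤j , j≤)) out =
    subst (λ n → δ i n ∈ particles μ) part≡j
      (∈-map⁺ (λ i → + part μ i ℤ.- + i) (∈-[1⋯] 1≤i i≤ℓ))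
    where
    part≡j : part μ i ≡ j
    part≡j = ≤-antisym (≮⇒≥ λ j< → out (∈λ-intro 1≤i (s≤s z≤n) j<)) j≤

  conjugatePart-colEnd : ∀ {i j} → (i , j) ∈λ → (suc i , j) ∉λ → conjugatePart μ j ≡ i
  conjugatePart-colEnd {i} {j} ((1≤i , _) , (1≤j , j≤)) out =
    count-≥ j 1≤j (parts μ) i
      (λ k k<i → ≤-trans j≤ (part-antitone (s≤s z≤n) k<i))
      (λ k i≤k → ≤-<-trans (part-antitone (s≤s z≤n) (s≤s i≤k))
                           (≰⇒> λ j≤ → out (∈λ-intro (s≤s z≤n) 1≤j j≤)))

  -- When column `suc j` ends in row `i`, its hole is `j - i`, one less than the content of its last
  -- cell.
  colEnd⇒hole : ∀ {i j} → (i , j) ∈λ → (suc i , j) ∉λ → HoleDiagonal (δ i j)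
  colEnd⇒hole {i} {suc j} p@((1≤i , _) , (1≤j , j≤)) out =
    _ , ∈-map⁺ (λ j → + j ℤ.- + 1 ℤ.- + conjugatePart μ j)
               (∈-[1⋯] 1≤j (≤-trans j≤ (part-antitone ≤-refl 1≤i)))
      , trans (δ-next i (suc j))
              (cong (ℤ._+ + 1) (trans (δ-suc i j)
                (cong (λ n → δ n j) (sym (conjugatePart-colEnd p out)))))

  -- Border strips.

  IsStrip : ℕ → ℕ → ℕ → Set
  IsStrip a b k = (k + a , k + b) ∈λ × (suc k + a , suc k + b) ∉λ

  -- Trades the maximum in `stripIndex` for the last cell on the diagonal through `(a , b)`, which
  -- is `k` steps away.
  strip : ∀ a b (p : (a , b) ∈λ) → ∃[ k ] stripIndex μ (cell a b p) ≡ suc k × IsStrip a b k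
  strip a b p@((1≤a , _) , _) = go _ refl
    where
    on : ℕ → ℕ × ℕ
    on r = a + r ∸ 1 , b + r ∸ 1

    on-suc : ∀ k → on (suc k) ≡ (k + a , k + b)
    on-suc k = cong₂ (λ m n → m ∸ 1 , n ∸ 1) (+-comm a (suc k)) (+-comm b (suc k))

    rs : List ℕ
    rs = filter (λ r → on r ∈ᵈ? μ) [1⋯ ℓ μ ]

    ∈-rs : ∀ k → (k + a , k + b) ∈λ → suc k ∈ rs
    ∈-rs k q@((_ , ≤ℓ) , _) =
      ∈-filter⁺ (λ r → on r ∈ᵈ? μ)
        -- `1 ≤ a` gives `suc k ≤ k + a ≤ ℓ μ`, so `suc k` is in the search range.
        (∈-[1⋯] (s≤s z≤n) (≤-trans (subst (_≤ k + a) (+-comm k 1) (+-monoʳ-≤ k 1≤a)) ≤ℓ))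
        (subst _∈λ (sym (on-suc k)) q)

    go : ∀ s → Extrema.max 0 rs ≡ s → ∃[ k ] s ≡ suc k × IsStrip a b k
    -- The cell itself puts 1 into `rs`, so the maximum is not the default 0.
    go zero eq =
      contradiction (subst (1 ≤_) eq (All.lookup (Extrema.xs≤max 0 rs) (∈-rs 0 p))) λ ()
    go (suc k) eq = k , refl , inside , outside
      where
      inside : (k + a , k + b) ∈λ
      inside with Extrema.argmax-sel (λ r → r) 0 rs
      ... | inj₁ max≡0 = contradiction (trans (sym max≡0) eq) λ ()
      ... | inj₂ max∈rs =
        subst _∈λ (on-suc k)
          (proj₂ (∈-filter⁻ (λ r → on r ∈ᵈ? μ) {xs = [1⋯ ℓ μ ]} (subst (_∈ rs) eq max∈rs)))

      outside : (suc k + a , suc k + b) ∉λ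
      outside q = <⇒≱ ≤-refl (subst (suc (suc k) ≤_) eq
        (All.lookup (Extrema.xs≤max 0 rs) (∈-rs (suc k) q)))

  -- The type of a slice depends only on the diagonal, so it is read off at the last cell there:
  -- either the column ends at that cell, or the cell one row further exists and ends its row, the
  -- next diagonal cell being outside.
  leftSlice : ∀ {i j} → (i , j) ∈λ →
              HoleDiagonal (δ i j) ⊎ ((suc i , j) ∈λ × ParticleDiagonal (δ (suc i) j))
  leftSlice {i} {j} p@(_ , (1≤j , _)) with strip i j p
  ... | k , _ , q , out with (suc k + i , k + j) ∈ᵈ? μ
  ... | yes q′ = inj₂ (down q′ (s≤s z≤n) 1≤j (s≤s (m≤n+m i k)) (m≤n+m j k) ,
                       subst ParticleDiagonal
                         (trans (cong (λ n → δ n (k + j)) (sym (+-suc k i))) (δ-+ k (suc i) j))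
                         (rowEnd⇒particle q′ out))
  ... | no out′ = inj₁ (subst HoleDiagonal (δ-+ k i j) (colEnd⇒hole q out′))

  -- The same argument with rows and columns exchanged.
  rightSlice : ∀ {i j} → (i , j) ∈λ →
               ParticleDiagonal (δ i j) ⊎ ((i , suc j) ∈λ × HoleDiagonal (δ i (suc j)))
  rightSlice {i} {j} p@((1≤i , _) , _) with strip i j p
  ... | k , _ , q , out with (k + i , suc k + j) ∈ᵈ? μ
  ... | yes q′ = inj₂ (down q′ 1≤i (s≤s z≤n) (m≤n+m i k) (s≤s (m≤n+m j k)) ,
                       subst HoleDiagonal
                         (trans (cong (δ (k + i)) (sym (+-suc k j))) (δ-+ k i (suc j)))
                         (colEnd⇒hole q′ out))
  ... | no out′ = inj₁ (subst ParticleDiagonal (δ-+ k i j) (rowEnd⇒particle q out′))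

  -- Moving the last cell of the diagonal one column to the right either stays in the diagram, and
  -- `k` is kept, or leaves it. In the latter case that last cell ends its row.
  col-neighbour-strips : ∀ {a b k k′} → IsStrip a b k → IsStrip a (suc b) k′ →
                         k ≡ k′ ⊎ (k ≡ suc k′ × ParticleDiagonal (δ a b))
  col-neighbour-strips {a} {b} {k} {k′} (q , out) (q′ , out′)
    with m≤n⇒m<n∨m≡n k≤1+k′
    where
    k≤1+k′ : k ≤ suc k′
    k≤1+k′ = ≮⇒≥ λ k′< → out′ (down q (s≤s z≤n) (s≤s z≤n)
      (+-monoˡ-≤ a (<⇒≤ k′<))
      (subst (_≤ k + b) (cong suc (sym (+-suc k′ b))) (+-monoˡ-≤ b k′<)))
  ... | inj₁ k≤k′ = inj₁ (≤-antisym (s≤s⁻¹ k≤k′) (≮⇒≥ λ k< → out (down q′ (s≤s z≤n) (s≤s z≤n)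
      (+-monoˡ-≤ a k<) (≤-trans (+-monoˡ-≤ b k<) (+-monoʳ-≤ k′ (n≤1+n b))))))
  ... | inj₂ refl = inj₂ (refl , subst ParticleDiagonal (δ-+ (suc k′) a b)
      (rowEnd⇒particle q (subst (λ n → (suc k′ + a , suc n) ∉λ) (+-suc k′ b) out′)))

  row-neighbour-strips : ∀ {a b k k′} → IsStrip a b k → IsStrip (suc a) b k′ →
                         k ≡ k′ ⊎ (k ≡ suc k′ × HoleDiagonal (δ a b))
  row-neighbour-strips {a} {b} {k} {k′} (q , out) (q′ , out′)
    with m≤n⇒m<n∨m≡n k≤1+k′
    where
    k≤1+k′ : k ≤ suc k′
    k≤1+k′ = ≮⇒≥ λ k′< → out′ (down q (s≤s z≤n) (s≤s z≤n)
      (subst (_≤ k + a) (cong suc (sym (+-suc k′ a))) (+-monoˡ-≤ a k′<))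
      (+-monoˡ-≤ b (<⇒≤ k′<)))
  ... | inj₁ k≤k′ = inj₁ (≤-antisym (s≤s⁻¹ k≤k′) (≮⇒≥ λ k< → out (down q′ (s≤s z≤n) (s≤s z≤n)
      (≤-trans (+-monoˡ-≤ a k<) (+-monoʳ-≤ k′ (n≤1+n a))) (+-monoˡ-≤ b k<))))
  ... | inj₂ refl = inj₂ (refl , subst HoleDiagonal (δ-+ (suc k′) a b)
      (colEnd⇒hole q (subst (λ n → (suc n , suc k′ + b) ∉λ) (+-suc k′ a) out′)))

  -- Fillings extended by zero, and their faces.

  module _ (Λ : Filling μ) where

    at-∈ : ∀ {i j} (p : (i , j) ∈λ) → Λ at (i , j) ≡ Λ (cell i j p)
    at-∈ {i} {j} p with (i , j) ∈ᵈ? μ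
    ... | yes _ = refl
    ... | no ¬p = contradiction p ¬p

    at-∉-≤ : ∀ {i j n} → (i , j) ∉λ → Λ at (i , j) ≤ n
    at-∉-≤ {i} {j} ¬p with (i , j) ∈ᵈ? μ
    ... | yes p = contradiction p ¬p
    ... | no _ = z≤n

    at-≤ : ∀ {i j n} → ((i , j) ∈λ → Λ at (i , j) ≤ n) → Λ at (i , j) ≤ n
    at-≤ {i} {j} {n} ≤n = decide ((i , j) ∈ᵈ? μ)
      where
      decide : Dec ((i , j) ∈λ) → Λ at (i , j) ≤ n
      decide (yes p) = ≤n p
      decide (no ¬p) = at-∉-≤ ¬p

    module _ (rpp : IsRPP Λ) where
      open IsRPP rpp

      at-row-mono : ∀ {i i′ j} → (i′ , j) ∈λ → i ≤ i′ → Λ at (i , j) ≤ Λ at (i′ , j)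
      at-row-mono {i} {i′} {j} p i≤i′ with (i , j) ∈ᵈ? μ
      ... | no _ = z≤n
      ... | yes q = subst (_ ≤_) (sym (at-∈ p))
                      (increasing-in-row-index (cell i j q) (cell i′ j p) refl i≤i′)

      at-col-mono : ∀ {i j j′} → (i , j′) ∈λ → j ≤ j′ → Λ at (i , j) ≤ Λ at (i , j′)
      at-col-mono {i} {j} {j′} p j≤j′ with (i , j) ∈ᵈ? μ
      ... | no _ = z≤n
      ... | yes q = subst (_ ≤_) (sym (at-∈ p))
                      (increasing-in-col-index (cell i j q) (cell i j′ p) refl j≤j′)

    -- Writing the column as `suc j` lets `j ∸ 1` in `leftFaces` reduce; for `j = 0` the lower bound
    -- is the conventional 0.
    ∈-leftFaces : ∀ {i j h} d → (i , suc j) ∈λ → δ i (suc j) ≡ d ℤ.+ + 1 →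
                  Λ at (i , j) < h → h ≤ Λ at (i , suc j) → h + i ∈ leftFaces Λ d
    ∈-leftFaces {i} d p eq lo hi =
      ∈-concatMap⁺ (λ (i , j) → map (_+ i) ⟨ Λ at (i , j ∸ 1) , Λ at (i , j) ])
        (lose (∈-diagonal p eq) (∈-map⁺ (_+ i) (∈-⟨] lo hi)))

    ∈-rightFaces : ∀ {i j h} → (suc i , j) ∈λ →
                   Λ at (i , j) < h → h ≤ Λ at (suc i , j) →
                   h + suc i ∈ rightFaces Λ (δ (suc i) j)
    ∈-rightFaces {i} p lo hi =
      ∈-concatMap⁺ (λ (i , j) → map (_+ i) ⟨ Λ at (i ∸ 1 , j) , Λ at (i , j) ])
        (lose (∈-diagonal p refl) (∈-map⁺ (_+ suc i) (∈-⟨] lo hi)))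

    ∈-topFaces : ∀ {i j} d → (i , j) ∈λ → δ i j ≡ d ℤ.+ + 1 →
                 Λ at (i , j) + i + 1 ∈ topFaces Λ d
    ∈-topFaces d p eq = ∈-map⁺ (λ (i , j) → Λ at (i , j) + i + 1) (∈-diagonal p eq)

-- Slice inequalities from the absence of coupled pairs.

module Uncoupled (μ : Partition) (Λ Λ′ : Filling μ) (rpp : IsRPP Λ) (rpp′ : IsRPP Λ′)
                 (g≡0 : g Λ Λ′ ≡ 0) where
  open Diagram μ

  module _ {d} (d∈H : d ∈ holes μ) where
    private
      pairs≡0 : ∣ leftFaces Λ d ∩ topFaces Λ′ d ∣ + ∣ leftFaces Λ d ∩ leftFaces Λ′ d ∣ ≡ 0
      pairs≡0 = ∑≡0⇒≡0 {holes μ} (m+n≡0⇒m≡0 _ g≡0) d∈H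

    left∩top : ∀ {v} → v ∈ leftFaces Λ d → v ∈ topFaces Λ′ d → ⊥
    left∩top = ∣∩∣≡0⇒disjoint (m+n≡0⇒m≡0 _ pairs≡0)

    left∩left : ∀ {v} → v ∈ leftFaces Λ d → v ∈ leftFaces Λ′ d → ⊥
    left∩left = ∣∩∣≡0⇒disjoint (m+n≡0⇒n≡0 ∣ leftFaces Λ d ∩ topFaces Λ′ d ∣ pairs≡0)

  module _ {d} (d∈D : d ∈ particles μ) where
    private
      pairs≡0 : ∣ rightFaces Λ d ∩ rightFaces Λ′ d ∣ + ∣ topFaces Λ d ∩ rightFaces Λ′ d ∣ ≡ 0
      pairs≡0 = ∑≡0⇒≡0 {particles μ} (m+n≡0⇒n≡0 (∑[ holes μ ] _) g≡0) d∈D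

    right∩right : ∀ {v} → v ∈ rightFaces Λ d → v ∈ rightFaces Λ′ d → ⊥
    right∩right = ∣∩∣≡0⇒disjoint (m+n≡0⇒m≡0 _ pairs≡0)

    top∩right : ∀ {v} → v ∈ topFaces Λ d → v ∈ rightFaces Λ′ d → ⊥
    top∩right = ∣∩∣≡0⇒disjoint (m+n≡0⇒n≡0 ∣ rightFaces Λ d ∩ rightFaces Λ′ d ∣ pairs≡0)

  -- The red top face over (i′ , suc j′) accounts for the extra height h′ = Λ′ + 1.
  hole-disjoint : ∀ {i j i′ j′ h h′} → HoleDiagonal (δ i (suc j)) →
    δ i′ (suc j′) ≡ δ i (suc j) → (i , suc j) ∈λ → (i′ , suc j′) ∈λ →
    Λ at (i , j) < h → h ≤ Λ at (i , suc j) →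
    Λ′ at (i′ , j′) < h′ → h′ ≤ suc (Λ′ at (i′ , suc j′)) →
    h + i ≡ h′ + i′ → ⊥
  hole-disjoint {i′ = i′} {j′} {h′ = h′} (d , d∈H , eq) eq′ p p′ lo hi lo′ hi′ h≡
    with m≤n⇒m<n∨m≡n hi′
  ... | inj₁ h′< = left∩left d∈H (∈-leftFaces Λ d p eq lo hi)
                     (subst (_∈ leftFaces Λ′ d) (sym h≡)
                       (∈-leftFaces Λ′ d p′ (trans eq′ eq) lo′ (s≤s⁻¹ h′<)))
  ... | inj₂ refl = left∩top d∈H (∈-leftFaces Λ d p eq lo hi)
                      (subst (_∈ topFaces Λ′ d) (trans (+-comm _ 1) (sym h≡))
                        (∈-topFaces Λ′ d p′ (trans eq′ eq)))

  -- The blue top face over (i , j) accounts for the extra height h = Λ at (i , j).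
  particle-disjoint : ∀ {i j i′ j′ h h′} → ParticleDiagonal (δ (suc i) j) →
    δ (suc i′) j′ ≡ δ (suc i) j → 1 ≤ i → (suc i , j) ∈λ → (suc i′ , j′) ∈λ →
    Λ at (i , j) ≤ h → h ≤ Λ at (suc i , j) →
    Λ′ at (i′ , j′) < h′ → h′ ≤ Λ′ at (suc i′ , j′) →
    h + suc i ≡ h′ + suc i′ → ⊥
  particle-disjoint {i} {j} {i′} {j′} {h} {h′} D eq′ 1≤i p@(_ , (1≤j , _)) p′ lo hi lo′ hi′ h≡
    with m≤n⇒m<n∨m≡n lo
       | subst (λ e → h′ + suc i′ ∈ rightFaces Λ′ e) eq′ (∈-rightFaces Λ′ p′ lo′ hi′)
  ... | inj₁ <h | red = right∩right D (∈-rightFaces Λ p <h hi)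
                          (subst (_∈ rightFaces Λ′ (δ (suc i) j)) (sym h≡) red)
  ... | inj₂ refl | red =
    top∩right D (∈-topFaces Λ (δ (suc i) j) (down p 1≤i 1≤j (n≤1+n i) ≤-refl) (δ-next i j))
      (subst (_∈ rightFaces Λ′ (δ (suc i) j))
        (trans (sym h≡) (trans (+-suc h i) (+-comm 1 (h + i)))) red)

  -- Otherwise height `Λ′ at (i , j) + 1` carries a blue left face. Red has a left face there too
  -- or, if its two entries agree, the top face over `(i , suc j)`.
  blue≤red-hole : ∀ {i j} → HoleDiagonal (δ i (suc j)) → (i , suc j) ∈λ →
                  Λ at (i , j) ≤ Λ′ at (i , j) → Λ at (i , suc j) ≤ Λ′ at (i , j)
  blue≤red-hole H p b≤r = ≮⇒≥ λ gt →
    hole-disjoint H refl p p (s≤s b≤r) gt ≤-refl (s≤s (at-col-mono Λ′ rpp′ p (n≤1+n _))) refl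

  -- Otherwise height `Λ at (suc i , j)` carries a red right face. Blue has a right face there or,
  -- if its two entries agree, the top face over `(i , j)`.
  blue≤red-particle : ∀ {i j} → ParticleDiagonal (δ (suc i) j) → 1 ≤ i → (suc i , j) ∈λ →
                      Λ at (suc i , j) ≤ Λ′ at (suc i , j) → Λ at (suc i , j) ≤ Λ′ at (i , j)
  blue≤red-particle D 1≤i p b≤r = ≮⇒≥ λ gt →
    particle-disjoint D refl 1≤i p p (at-row-mono Λ rpp p (n≤1+n _)) ≤-refl gt b≤r refl

  -- The red top face over `(i , suc j)` meets a blue left face one row further: the extra 1 in the
  -- position of a top face makes up for the smaller row index.
  red≤blue-hole : ∀ {i j} → HoleDiagonal (δ (suc i) (suc (suc j))) → 1 ≤ i →
                  (suc i , suc (suc j)) ∈λ →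
                  Λ′ at (i , suc j) ≤ Λ at (suc i , suc (suc j)) →
                  Λ′ at (i , suc j) ≤ Λ at (suc i , suc j)
  red≤blue-hole {i} {j} H 1≤i p r≤b = ≮⇒≥ λ gt →
    hole-disjoint H (sym (δ-suc i (suc j)))
      p q gt r≤b (s≤s (at-col-mono Λ′ rpp′ q (n≤1+n _))) ≤-refl (+-suc _ i)
    where
    q : (i , suc j) ∈λ
    q = down-suc p 1≤i (s≤s z≤n)

  -- The blue top face over `(suc i , suc j)` meets a red right face over `(suc i , j)`, at height
  -- `Λ at (suc i , suc j) + 1`.
  red≤blue-particle : ∀ {i j} → ParticleDiagonal (δ (suc (suc i)) (suc j)) → 1 ≤ j →
                      (suc (suc i) , suc j) ∈λ →
                      Λ′ at (i , j) ≤ Λ at (suc i , suc j) →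
                      Λ′ at (suc i , j) ≤ Λ at (suc i , suc j)
  red≤blue-particle {i} {j} D 1≤j p r≤b = ≮⇒≥ λ gt →
    particle-disjoint D (sym (δ-suc (suc i) j))
      (s≤s z≤n) p (down-suc p (s≤s z≤n) 1≤j)
      ≤-refl (at-row-mono Λ rpp p (n≤1+n _)) (s≤s r≤b) gt (+-suc _ (suc i))

  -- Spreading the two inequalities over all diagonals.

  private
    -- A hole slice leads back one column and lowers `j`. A particle slice leads up one row and
    -- lowers `m`, which bounds the number of rows above. Both lead to the preceding diagonal.
    blue≤red-from : ∀ m j i → ℓ μ ≤ m + i → (i , j) ∈λ → Λ at (i , j) ≤ Λ′ at (i , j)
    blue≤red-from m zero i _ (_ , (() , _))
    blue≤red-from m (suc j) i ℓ≤ p with leftSlice p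
    blue≤red-from m (suc j) i ℓ≤ p | inj₁ H =
      -- `at-≤` covers column 0, where blue is 0.
      ≤-trans (blue≤red-hole H p (at-≤ Λ (blue≤red-from m j i ℓ≤)))
              (at-col-mono Λ′ rpp′ p (n≤1+n j))
    blue≤red-from zero (suc j) i ℓ≤ p | inj₂ (((_ , i<ℓ) , _) , D) = contradiction ℓ≤ (<⇒≱ i<ℓ)
    blue≤red-from (suc m) (suc j) i ℓ≤ p@((1≤i , _) , _) | inj₂ (q , D) =
      ≤-trans (at-row-mono Λ rpp q (n≤1+n i))
        (blue≤red-particle D 1≤i q
          (blue≤red-from m (suc j) (suc i) (subst (ℓ μ ≤_) (sym (+-suc m i)) ℓ≤) q))

    -- The mirror induction, towards the following diagonal: a particle slice lowers `i`, a hole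
    -- slice raises `j` and lowers `n`, which bounds the columns still to the right. In row 0 and
    -- column 0 red is 0.
    red≤blue-from : ∀ n i j → part μ 1 ≤ n + j → (suc i , suc j) ∈λ →
                    Λ′ at (i , j) ≤ Λ at (suc i , suc j)
    red≤blue-from n zero j _ p = at-∉-≤ Λ′ {0} {j} λ where ((() , _) , _)
    red≤blue-from n (suc i) zero _ p = at-∉-≤ Λ′ {suc i} {0} λ where (_ , (() , _))
    red≤blue-from n (suc i) (suc j) ≤n p with rightSlice p
    red≤blue-from n (suc i) (suc j) ≤n p | inj₁ D =
      ≤-trans (red≤blue-particle D (s≤s z≤n) p
                (red≤blue-from n i (suc j) ≤n (down p (s≤s z≤n) (s≤s z≤n) (n≤1+n _) ≤-refl)))
              (at-row-mono Λ rpp p (n≤1+n _))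
    red≤blue-from zero (suc i) (suc j) ≤n p | inj₂ ((_ , (_ , j<)) , H) =
      contradiction (≤-trans j< (≤-trans (part-antitone ≤-refl (s≤s z≤n)) ≤n))
                    (<⇒≱ (s≤s (n≤1+n _)))
    red≤blue-from (suc n) (suc i) (suc j) ≤n p | inj₂ (q , H) =
      ≤-trans (at-col-mono Λ′ rpp′ (down-suc q (s≤s z≤n) (s≤s z≤n)) (n≤1+n _))
        (red≤blue-hole H (s≤s z≤n) q
          (red≤blue-from n (suc i) (suc (suc j))
            (subst (part μ 1 ≤_) (sym (+-suc n (suc j))) ≤n) q))

  blue≤red : ∀ {i j} → (i , j) ∈λ → Λ at (i , j) ≤ Λ′ at (i , j)
  blue≤red {i} {j} = blue≤red-from (ℓ μ) j i (m≤m+n _ i)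

  red≤blue : ∀ {i j} → (suc i , suc j) ∈λ → Λ′ at (i , j) ≤ Λ at (suc i , suc j)
  red≤blue {i} {j} = red≤blue-from (part μ 1) i j (m≤m+n _ j)

  -- The entries of `Λ″` strip by strip.

  -- The value of Λ″ at (a , b) when (a , b) lies in the (k + 1)-th border strip.
  entry : ℕ → ℕ → ℕ → ℕ
  entry a b zero = Λ′ at (a , b)
  entry a b (suc zero) = Λ at (suc a , suc b)
  entry a b (suc (suc k)) = entry (suc a) (suc b) k

  private
    -- With the parity detached from `s`, raising `s` by 2 only raises `⌈ s /2⌉` by 1; this is the
    -- recursion of `entry`.
    formula : ℕ → ℕ → ℕ → Parity → ℕ
    formula a b s 1ℙ = Λ′ at (a + ⌈ s /2⌉ ∸ 1 , b + ⌈ s /2⌉ ∸ 1)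
    formula a b s 0ℙ = Λ at (a + ⌈ s /2⌉ , b + ⌈ s /2⌉)

    shiftStrips-formula : ∀ a b p → let s = stripIndex μ (cell a b p) in
                          shiftStrips Λ Λ′ (cell a b p) ≡ formula a b s (parity s)
    shiftStrips-formula a b p with parity (stripIndex μ (cell a b p))
    ... | 0ℙ = refl
    ... | 1ℙ = refl

    formula-suc : ∀ a b s x → formula a b (suc (suc s)) x ≡ formula (suc a) (suc b) s x
    formula-suc a b s 0ℙ = cong₂ (λ i j → Λ at (i , j)) (+-suc a ⌈ s /2⌉) (+-suc b ⌈ s /2⌉)
    formula-suc a b s 1ℙ =
      cong₂ (λ i j → Λ′ at (i ∸ 1 , j ∸ 1)) (+-suc a ⌈ s /2⌉) (+-suc b ⌈ s /2⌉)

    formula-entry : ∀ a b k → formula a b (suc k) (parity (suc k)) ≡ entry a b k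
    formula-entry a b zero =
      cong₂ (λ i j → Λ′ at (i ∸ 1 , j ∸ 1)) (+-comm a 1) (+-comm b 1)
    formula-entry a b (suc zero) = cong₂ (λ i j → Λ at (i , j)) (+-comm a 1) (+-comm b 1)
    formula-entry a b (suc (suc k)) =
      trans (formula-suc a b (suc k) (parity (suc (suc (suc k)))))
            (formula-entry (suc a) (suc b) k)

  shiftStrips-entry : ∀ {a b k} p → stripIndex μ (cell a b p) ≡ suc k →
                      shiftStrips Λ Λ′ (cell a b p) ≡ entry a b k
  shiftStrips-entry {a} {b} {k} p eq =
    trans (shiftStrips-formula a b p)
      (trans (cong (λ s → formula a b s (parity s)) eq) (formula-entry a b k))

  -- Cells of one strip take their values from the same filling under the same shift, so the
  -- monotonicity of that filling suffices.
  entry-col : ∀ k {a b} → (k + a , k + suc b) ∈λ → entry a b k ≤ entry a (suc b) k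
  entry-col zero p = at-col-mono Λ′ rpp′ p (n≤1+n _)
  entry-col (suc zero) p = at-col-mono Λ rpp p (n≤1+n _)
  entry-col (suc (suc k)) {a} {b} p =
    entry-col k (subst₂ (λ i j → (i , j) ∈λ) (sym (+-suc k a)) (sym (+-suc k (suc b)))
      (down-suc p (s≤s z≤n) (s≤s z≤n)))

  entry-row : ∀ k {a b} → (k + suc a , k + b) ∈λ → entry a b k ≤ entry (suc a) b k
  entry-row zero p = at-row-mono Λ′ rpp′ p (n≤1+n _)
  entry-row (suc zero) p = at-row-mono Λ rpp p (n≤1+n _)
  entry-row (suc (suc k)) {a} {b} p =
    entry-row k (subst₂ (λ i j → (i , j) ∈λ) (sym (+-suc k (suc a))) (sym (+-suc k b))
      (down-suc p (s≤s z≤n) (s≤s z≤n)))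

  -- Consecutive strips have different colours: `k = 0` compares blue with red, `k = 1` red with
  -- blue, and two strips more amount to one diagonal step.
  entry-col-drop : ∀ k {a b} → ParticleDiagonal (δ a b) → 1 ≤ a → (suc k + a , suc k + b) ∈λ →
                   entry a b (suc k) ≤ entry a (suc b) k
  entry-col-drop zero {a} {b} D 1≤a p =
    blue≤red-particle (subst ParticleDiagonal (sym (δ-suc a b)) D) 1≤a p (blue≤red p)
  entry-col-drop (suc zero) {a} {b} D 1≤a p =
    red≤blue-particle (subst ParticleDiagonal (sym (δ-+ 2 a b)) D) (s≤s z≤n) p
      (red≤blue (down p (s≤s z≤n) (s≤s z≤n) (n≤1+n _) ≤-refl))
  entry-col-drop (suc (suc k)) {a} {b} D 1≤a p =
    entry-col-drop k (subst ParticleDiagonal (sym (δ-suc a b)) D) (s≤s z≤n)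
      (subst₂ (λ i j → (suc i , suc j) ∈λ) (sym (+-suc k a)) (sym (+-suc k b))
        (down-suc p (s≤s z≤n) (s≤s z≤n)))

  entry-row-drop : ∀ k {a b} → HoleDiagonal (δ a b) → (suc k + a , suc k + b) ∈λ →
                   entry a b (suc k) ≤ entry (suc a) b k
  entry-row-drop zero {a} {b} H p =
    -- For `b = 0` the cell `(suc a , b)` is outside, and blue is 0 there.
    blue≤red-hole (subst HoleDiagonal (sym (δ-suc a b)) H) p (at-≤ Λ {suc a} {b} blue≤red)
  entry-row-drop (suc zero) {a} {b} H p =
    red≤blue-hole (subst HoleDiagonal (sym (δ-+ 2 a b)) H) (s≤s z≤n) p (red≤blue p)
  entry-row-drop (suc (suc k)) {a} {b} H p =
    entry-row-drop k (subst HoleDiagonal (sym (δ-suc a b)) H)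
      (subst₂ (λ i j → (suc i , suc j) ∈λ) (sym (+-suc k a)) (sym (+-suc k b))
        (down-suc p (s≤s z≤n) (s≤s z≤n)))

  Λ″ : Filling μ
  Λ″ = shiftStrips Λ Λ′

  -- Monotonicity of `Λ″`, first for neighbours.

  col-step : ∀ {a b} (p : (a , b) ∈λ) (q : (a , suc b) ∈λ) →
             Λ″ (cell a b p) ≤ Λ″ (cell a (suc b) q)
  col-step {a} {b} p@((1≤a , _) , _) q with strip a b p | strip a (suc b) q
  ... | k , eq , s | k′ , eq′ , s′
    rewrite shiftStrips-entry p eq | shiftStrips-entry q eq′
    with col-neighbour-strips {a} {b} {k} {k′} s s′
  ... | inj₁ refl = entry-col k (proj₁ s′)
  ... | inj₂ (refl , D) = entry-col-drop k′ D 1≤a (proj₁ s)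

  row-step : ∀ {a b} (p : (a , b) ∈λ) (q : (suc a , b) ∈λ) →
             Λ″ (cell a b p) ≤ Λ″ (cell (suc a) b q)
  row-step {a} {b} p q with strip a b p | strip (suc a) b q
  ... | k , eq , s | k′ , eq′ , s′
    rewrite shiftStrips-entry p eq | shiftStrips-entry q eq′
    with row-neighbour-strips {a} {b} {k} {k′} s s′
  ... | inj₁ refl = entry-row k (proj₁ s′)
  ... | inj₂ (refl , H) = entry-row-drop k′ H (proj₁ s)

  col-mono : ∀ {a b b′} → b ≤′ b′ → (p : (a , b) ∈λ) (q : (a , b′) ∈λ) →
             Λ″ (cell a b p) ≤ Λ″ (cell a b′ q)
  col-mono ≤′-refl p q = ≤-refl
  col-mono {a} (≤′-step {n} b≤n) p@((1≤a , _) , (1≤b , _)) q =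
    ≤-trans (col-mono b≤n p r) (col-step r q)
    where
    r : (a , n) ∈λ
    r = down q 1≤a (≤-trans 1≤b (≤′⇒≤ b≤n)) ≤-refl (n≤1+n n)

  row-mono : ∀ {a a′ b} → a ≤′ a′ → (p : (a , b) ∈λ) (q : (a′ , b) ∈λ) →
             Λ″ (cell a b p) ≤ Λ″ (cell a′ b q)
  row-mono ≤′-refl p q = ≤-refl
  row-mono {b = b} (≤′-step {n} a≤n) p@((1≤a , _) , (1≤b , _)) q =
    ≤-trans (row-mono a≤n p r) (row-step r q)
    where
    r : (n , b) ∈λ
    r = down q (≤-trans 1≤a (≤′⇒≤ a≤n)) 1≤b (n≤1+n n) ≤-refl

  shiftStrips-isRPP : IsRPP Λ″
  shiftStrips-isRPP = record
    { increasing-in-row-index = λ where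
        (cell a b p) (cell a′ .b p′) refl a≤a′ →
          -- Membership is irrelevant in `Cell` but inspected by `row-mono`; decidability recovers
          -- it.
          row-mono (≤⇒≤′ a≤a′) (recompute ((a , b) ∈ᵈ? μ) p) (recompute ((a′ , b) ∈ᵈ? μ) p′)
    ; increasing-in-col-index = λ where
        (cell a b p) (cell .a b′ p′) refl b≤b′ →
          col-mono (≤⇒≤′ b≤b′) (recompute ((a , b) ∈ᵈ? μ) p) (recompute ((a , b′) ∈ᵈ? μ) p′)
    }

proposition5p4 : (μ : Partition) (Λ Λ′ : Filling μ) →
    IsRPP Λ → IsRPP Λ′ → g Λ Λ′ ≡ 0 → IsRPP (shiftStrips Λ Λ′)
proposition5p4 = Uncoupled.shiftStrips-isRPP
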